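{- Suppose $p \colon \mathbb{N} \to (1,\infty)$ is an order function, and let $r \colon \mathbb{N} \to \mathbb{N}$ be any order function such that $\lim_{n \to \infty} r(n)/2^n = \infty$. Let $F\colon\mathbb{N}\to\mathbb{N}$ be $F(n)=\sum_{i < r(n)}\lfloor \log_2 p(i) \rfloor$. Then $$\mathrm{COMPLEX}\bigl(F^{\mathrm{inv}}\bigr) \leq_{\mathrm{s}} \mathrm{LUA}(p).$$
   Context: An order function is a computable (i.e. its values are uniformly computable reals), nondecreasing, unbounded function $\mathbb{N}\to\mathbb{R}$. For nondecreasing unbounded $F\colon\mathbb{N}\to\mathbb{R}$, $F^{\mathrm{inv}}(x)$ is the least $m\in\mathbb{N}$ with $F(m)\geq x$; here it is regarded as a function $\mathbb{N}\to\mathbb{N}$. Prefix-free complexity: a prefix-free machine is a partial recursive $M$ from $\{0,1\}^*$ to $\{0,1\}^*$ with prefix-free domain; $U$ is universal if for each prefix-free machine $M$ there is $\rho$ with $U(\rho^\frown\tau)\simeq M(\tau)$ for all $\tau$. Fix a universal $U$ and let $K(\sigma)=\min\{|\tau| : U(\tau)=\sigma\}$. For $f\colon\mathbb{N}\to\mathbb{R}$, $\mathrm{COMPLEX}(f)$ is the set of $X\in\{0,1\}^{\mathbb{N}}$ for which there is $c\in\mathbb{N}$ with $K(X\upharpoonright n)\geq f(n)-c$ for all $n$. A partial recursive $\psi\colon\subseteq\mathbb{N}\to\mathbb{N}$ is linearly universal if for every partial recursive $\theta\colon\subseteq\mathbb{N}\to\mathbb{N}$ there are $a,b\in\mathbb{N}$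 with $\psi(ax+b)\simeq\theta(x)$ for all $x$. For $p\colon\mathbb{N}\to(1,\infty)$, $\mathrm{LUA}(p)$ is the set of $X\in\mathbb{N}^{\mathbb{N}}$ such that $X(n)<p(n)$ for all $n$ and, for some linearly universal partial recursive $\psi$, there is no $n\in\operatorname{dom}\psi$ with $X(n)=\psi(n)$. For $P,Q\subseteq\mathbb{N}^{\mathbb{N}}$, $P\leq_{\mathrm{s}}Q$ means there is a partial recursive functional defined on all of $Q$ that maps $Q$ into $P$. -}

module Defs where

open import Data.Bool.Base using (Bool; true; false)
open import Data.Empty using (⊥)
open import Data.Fin.Base using (Fin)
open import Data.Integer.Base as ℤ using (+_)
open import Data.List.Base using (List; []; _∷_; _++_; length; applyUpTo)
open import Data.List.Relation.Binary.Prefix.Heterogeneous using (Prefix)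
open import Data.Nat.Base as ℕ using (ℕ; zero; suc)
open import Data.Product.Base using (∃; _×_)
open import Data.Rational.Base as ℚ using (ℚ; 1ℚ; ½)
import Data.Rational.Properties as ℚₚ
open import Data.Unit.Base using (⊤)
open import Data.Vec.Base as Vec using (Vec; lookup)
open import Data.Vec.Relation.Binary.Pointwise.Inductive using (Pointwise)
open import Function.Bundles using (_⇔_)
open import Level using (0ℓ)
open import Relation.Binary.PropositionalEquality using (_≡_; sym; subst; cong)
open import Relation.Nullary using (¬_)
open import Relation.Unary using (Pred; _∈_)

-- Kleene's μ-recursive schemes with one unary oracle for each element of O.
data Code (O : Set) : ℕ → Set where
  zeroᶜ  : Code O 0
  sucᶜ   : Code O 1
  proj   : ∀ {n} → Fin n → Code O n
  comp   : ∀ {m n} → Code O m → Vec (Code O n) m → Code O n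
  rec    : ∀ {n} → Code O n → Code O (2 ℕ.+ n) → Code O (suc n)
  μ      : ∀ {n} → Code O (suc n) → Code O n
  oracle : O → Code O 1

-- Eval φ e xs y: with the oracles answered by φ, the computation of e on
-- input xs converges with output y.
data Eval {O : Set} (φ : O → ℕ → ℕ) : ∀ {n} → Code O n → Vec ℕ n → ℕ → Set where
  ev-zero   : Eval φ zeroᶜ Vec.[] 0
  ev-suc    : ∀ {x} → Eval φ sucᶜ Vec.[ x ] (suc x)
  ev-proj   : ∀ {n} {xs : Vec ℕ n} i → Eval φ (proj i) xs (lookup xs i)
  ev-comp   : ∀ {m n} {f : Code O m} {gs : Vec (Code O n) m} {xs ys z} →
              Pointwise (λ g y → Eval φ g xs y) gs ys → Eval φ f ys z →
              Eval φ (comp f gs) xs z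
  ev-rec0   : ∀ {n} {f : Code O n} {g xs y} →
              Eval φ f xs y → Eval φ (rec f g) (0 Vec.∷ xs) y
  ev-recs   : ∀ {n} {f : Code O n} {g xs k y z} →
              Eval φ (rec f g) (k Vec.∷ xs) y →
              Eval φ g (k Vec.∷ y Vec.∷ xs) z →
              Eval φ (rec f g) (suc k Vec.∷ xs) z
  ev-μ      : ∀ {n} {f : Code O (suc n)} {xs y} →
              (∀ i → i ℕ.< y → ∃ λ v → Eval φ f (i Vec.∷ xs) (suc v)) →
              Eval φ f (y Vec.∷ xs) 0 →
              Eval φ (μ f) xs y
  ev-oracle : ∀ {o x} → Eval φ (oracle o) Vec.[ x ] (φ o x)

noOracle : ⊥ → ℕ → ℕ
noOracle ()

PartialRecursive : Set
PartialRecursive = Code ⊥ 1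

infix 4 _⟨_⟩⇓_ _⟨_⟩⇓ _⟪_⟫_⇓_

_⟨_⟩⇓_ : PartialRecursive → ℕ → ℕ → Set
ψ ⟨ x ⟩⇓ y = Eval noOracle ψ Vec.[ x ] y

-- A partial recursive functional Φ sends X to Y when, for every n, Φ with
-- oracle X converges on n to Y(n).
Functional : Set
Functional = Code ⊤ 1

_⟪_⟫_⇓_ : Functional → (ℕ → ℕ) → ℕ → ℕ → Set
Φ ⟪ X ⟫ n ⇓ y = Eval (λ _ → X) Φ Vec.[ n ] y

Recursive₂ : (ℕ → ℕ → ℕ) → Set
Recursive₂ f = ∃ λ (e : Code ⊥ 2) → ∀ m n → Eval noOracle e (m Vec.∷ n Vec.∷ Vec.[]) (f m n)

infix 4 _≤ₛ_

_≤ₛ_ : Pred (ℕ → ℕ) 0ℓ → Pred (ℕ → ℕ) 0ℓ → Set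
P ≤ₛ Q = ∃ λ (Φ : Functional) → ∀ X → X ∈ Q →
         ∃ λ Y → (∀ n → Φ ⟪ X ⟫ n ⇓ Y n) × Y ∈ P

2^-_ : ℕ → ℚ
2^- zero  = 1ℚ
2^- suc k = ½ ℚ.* 2^- k

2^-nonNeg : ∀ k → ℚ.NonNegative (2^- k)
2^-nonNeg zero    = _
2^-nonNeg (suc k) = ℚₚ.nonNeg*nonNeg⇒nonNeg ½ (2^- k) {{2^-nonNeg k}}

-- Regular Cauchy sequences: approx x k is within 2^-k of the real x.
record ℝ : Set where
  field
    approx  : ℕ → ℚ
    regular : ∀ m n → ℚ.∣ approx m ℚ.- approx n ∣ ℚ.≤ 2^- m ℚ.+ 2^- n

open ℝ public

infix 4 _<ᴿ_ _≤ᴿ_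

_<ᴿ_ : ℝ → ℝ → Set
x <ᴿ y = ∃ λ k → approx x k ℚ.+ 2^- k ℚ.< approx y k ℚ.- 2^- k

-- The negation of y <ᴿ x.
_≤ᴿ_ : ℝ → ℝ → Set
x ≤ᴿ y = ∀ k → approx x k ℚ.- 2^- k ℚ.≤ approx y k ℚ.+ 2^- k

fromℚ : ℚ → ℝ
fromℚ q = record
  { approx  = λ _ → q
  ; regular = λ m n → subst (ℚ._≤ 2^- m ℚ.+ 2^- n)
      (cong ℚ.∣_∣ (sym (ℚₚ.+-inverseʳ q)))
      (ℚₚ.nonNegative⁻¹ _ {{ℚₚ.nonNeg+nonNeg⇒nonNeg (2^- m) {{2^-nonNeg m}}
                                                   (2^- n) {{2^-nonNeg n}}}})
  }

fromℕ : ℕ → ℝ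
fromℕ n = fromℚ (+ n ℚ./ 1)

-- Every rational is of the form (a - b) / (1 + d) with a, b, d ∈ ℕ.
Recursiveℚ : (ℕ → ℕ → ℚ) → Set
Recursiveℚ g = ∃ λ a → ∃ λ b → ∃ λ d →
  Recursive₂ a × Recursive₂ b × Recursive₂ d ×
  (∀ n k → g n k ≡ (a n k ℤ.⊖ b n k) ℚ./ suc (d n k))

UniformlyComputable : (ℕ → ℝ) → Set
UniformlyComputable f = ∃ λ g → Recursiveℚ g ×
  (∀ n k → fromℚ (g n k ℚ.- 2^- k) ≤ᴿ f n × f n ≤ᴿ fromℚ (g n k ℚ.+ 2^- k))

record IsOrderFunction (f : ℕ → ℝ) : Set where
  field
    computable    : UniformlyComputable f
    nondecreasing : ∀ m n → m ℕ.≤ n → f m ≤ᴿ f n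
    unbounded     : ∀ (B : ℝ) → ∃ λ n → B <ᴿ f n

TendsTo∞ : (ℕ → ℝ) → Set
TendsTo∞ s = ∀ (B : ℝ) → ∃ λ N → ∀ n → N ℕ.≤ n → B <ᴿ s n

-- k = ⌊log₂ x⌋, that is, k ≤ log₂ x < k + 1.
IsFloorLog₂ : ℝ → ℕ → Set
IsFloorLog₂ x k = fromℕ (2 ℕ.^ k) ≤ᴿ x × x <ᴿ fromℕ (2 ℕ.^ suc k)

IsInv : (ℕ → ℝ) → (ℕ → ℕ) → Set
IsInv F G = ∀ x → fromℕ x ≤ᴿ F (G x) × (∀ m → fromℕ x ≤ᴿ F m → G x ℕ.≤ m)

Str : Set
Str = List Bool

-- The bijection {0,1}* ≅ ℕ given by bijective base-2 numeration, least
-- significant digit first.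
⌜_⌝ : Str → ℕ
⌜ []        ⌝ = 0
⌜ false ∷ σ ⌝ = 1 ℕ.+ 2 ℕ.* ⌜ σ ⌝
⌜ true  ∷ σ ⌝ = 2 ℕ.+ 2 ℕ.* ⌜ σ ⌝

-- Partial recursive functions on strings are those on ℕ, transported along ⌜_⌝.
_⟨_⟩≃_ : PartialRecursive → Str → Str → Set
M ⟨ τ ⟩≃ σ = M ⟨ ⌜ τ ⌝ ⟩⇓ ⌜ σ ⌝

_⟨_⟩⇓ : PartialRecursive → Str → Set
M ⟨ τ ⟩⇓ = ∃ λ σ → M ⟨ τ ⟩≃ σ

PrefixFree : PartialRecursive → Set
PrefixFree M = ∀ σ τ → M ⟨ σ ⟩⇓ → M ⟨ τ ⟩⇓ → Prefix _≡_ σ τ → σ ≡ τ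

IsUniversal : PartialRecursive → Set
IsUniversal U = PrefixFree U ×
  (∀ M → PrefixFree M → ∃ λ ρ → ∀ τ σ → U ⟨ ρ ++ τ ⟩≃ σ ⇔ M ⟨ τ ⟩≃ σ)

-- k = K(σ), computed with respect to U. As K is not computable, it is given
-- by its graph.
IsK : PartialRecursive → Str → ℕ → Set
IsK U σ k = (∃ λ τ → U ⟨ τ ⟩≃ σ × length τ ≡ k) ×
            (∀ τ → U ⟨ τ ⟩≃ σ → k ℕ.≤ length τ)

bit : Bool → ℕ
bit false = 0
bit true  = 1

-- COMPLEX(f) as a subset of Baire space, via {0,1}^ℕ ⊆ ℕ^ℕ. Here
-- K(X↾n) ≥ f(n) - c is written f(n) ≤ K(X↾n) + c.
COMPLEX : PartialRecursive → (ℕ → ℝ) → Pred (ℕ → ℕ) 0ℓ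
COMPLEX U f Y = ∃ λ (X : ℕ → Bool) → (∀ n → Y n ≡ bit (X n)) ×
  (∃ λ c → ∀ n k → IsK U (applyUpTo X n) k → f n ≤ᴿ fromℕ (k ℕ.+ c))

LinearlyUniversal : PartialRecursive → Set
LinearlyUniversal ψ = ∀ (θ : PartialRecursive) → ∃ λ a → ∃ λ b →
  ∀ x y → ψ ⟨ a ℕ.* x ℕ.+ b ⟩⇓ y ⇔ θ ⟨ x ⟩⇓ y

LUA : (ℕ → ℝ) → Pred (ℕ → ℕ) 0ℓ
LUA p X = (∀ n → fromℕ (X n) <ᴿ p n) ×
  (∃ λ ψ → LinearlyUniversal ψ × ¬ (∃ λ n → ψ ⟨ n ⟩⇓ X n))

{-# OPTIONS --safe #-}
module Submission where

-- The bits of X are concatenated to Y in blocks of width v i + 2 ≥ log₂ p i, where v i ≤ log₂ p i is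
-- a computable lower bound.  Each block is up to two bits longer than its budget, so once every
-- ⌊v i / 2⌋ indices a block is skipped, and its budget pays for the following ones.  If U(τ) is a
-- prefix of Y covering the first r(|τ| + c) indices, a partial recursive θ that reads block i off
-- U(τ) computes X i.  Linear universality turns θ into ψ along some i = a z + b; the code z of τ also
-- carries a and b, which lets θ know i.  Two codes z, z + 1 are kept for each τ: as v → ∞, the
-- indices a z + b and a (z + 1) + b are not both skipped, and so ψ meets X.

open import Defs
open import Data.Bool.Base using (Bool; true; false; not)
open import Data.Bool.Properties using (not-involutive)
open import Data.Empty using (⊥)
open import Data.Fin.Base using (Fin)
open import Data.Fin.Patterns
open import Data.Integer.Base as ℤ using (+_)
import Data.Integer.Properties as ℤₚ
import Data.Integer.Solver as ℤ-Solver
open import Data.List.Base using (applyUpTo; []; _∷_; _∷ʳ_; length)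
open import Data.List.Properties using (applyUpTo-∷ʳ)
open import Data.Nat.Base hiding (parity; _/_)
open import Data.Nat.GeneralisedArithmetic using (fold; fold-+)
open import Data.Nat.ListAction using (sum)
open import Data.Nat.ListAction.Properties using (sum-++)
open import Data.Nat.Properties
open import Data.Nat.Solver using (module +-*-Solver)
open import Data.Product.Base using (∃; _×_; _,_; proj₁; proj₂)
open import Data.Rational.Base as ℚ using (ℚ; _/_; 1ℚ; ½; toℚᵘ)
import Data.Rational.Properties as ℚₚ
open import Data.Rational.Unnormalised.Base as ℚᵘ using (mkℚᵘ)
import Data.Rational.Unnormalised.Properties as ℚᵘₚ
open import Data.Sum.Base using ([_,_]′)
open import Data.Vec.Base using (Vec; []; _∷_; lookup)
open import Data.Vec.Relation.Binary.Pointwise.Inductive using (Pointwise; []; _∷_)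
open import Function.Bundles using (Equivalence)
open import Relation.Binary.PropositionalEquality
open import Relation.Nullary using (yes; no; contradiction; ¬_)
open import Relation.Nullary.Decidable using (toSum)

open +-*-Solver using (solve; con; _:+_; _:*_; _:=_)

-- Partial recursive codes

mutual
  -- The recursive functions provided by `UniformlyComputable` have no oracle but must run inside a
  -- functional that has one. A `Code ⊥ n` cannot contain an oracle, so that constructor has no
  -- clause.
  addOracle : ∀ {O n} → Code ⊥ n → Code O n
  addOracle zeroᶜ       = zeroᶜ
  addOracle sucᶜ        = sucᶜ
  addOracle (proj i)    = proj i
  addOracle (comp f gs) = comp (addOracle f) (addOracles gs)
  addOracle (rec f g)   = rec (addOracle f) (addOracle g)
  addOracle (μ f)       = μ (addOracle f)

  addOracles : ∀ {O n m} → Vec (Code ⊥ n) m → Vec (Code O n) m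
  addOracles []       = []
  addOracles (g ∷ gs) = addOracle g ∷ addOracles gs

mutual
  addOracle-Eval : ∀ {O n} {φ : O → ℕ → ℕ} {e : Code ⊥ n} {xs y} →
                   Eval noOracle e xs y → Eval φ (addOracle e) xs y
  addOracle-Eval ev-zero         = ev-zero
  addOracle-Eval ev-suc          = ev-suc
  addOracle-Eval (ev-proj i)     = ev-proj i
  addOracle-Eval (ev-comp gs f)  = ev-comp (addOracles-Eval gs) (addOracle-Eval f)
  addOracle-Eval (ev-rec0 f)     = ev-rec0 (addOracle-Eval f)
  addOracle-Eval (ev-recs r g)   = ev-recs (addOracle-Eval r) (addOracle-Eval g)
  addOracle-Eval (ev-μ below at) = ev-μ
    (λ i i<y → proj₁ (below i i<y) , addOracle-Eval (proj₂ (below i i<y)))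
    (addOracle-Eval at)
  addOracle-Eval (ev-oracle {o = ()})

  addOracles-Eval : ∀ {O n m} {φ : O → ℕ → ℕ} {gs : Vec (Code ⊥ n) m} {xs ys} →
                    Pointwise (λ g y → Eval noOracle g xs y) gs ys →
                    Pointwise (λ g y → Eval φ g xs y) (addOracles gs) ys
  addOracles-Eval []       = []
  addOracles-Eval (g ∷ gs) = addOracle-Eval g ∷ addOracles-Eval gs

-- Correctness holds for every `φ`, and `O` is left open: the same construction serves in the
-- functional, where `O` is `⊤`, and in `θ`, where `O` is `⊥`.
record Computable (O : Set) {n} (f : Vec ℕ n → ℕ) : Set where
  constructor computes
  field
    code    : Code O n
    correct : ∀ φ xs → Eval φ code xs (f xs)

record Computable₁ (O : Set) (f : ℕ → ℕ) : Set where
  constructor computes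
  field
    code    : Code O 1
    correct : ∀ φ x → Eval φ code (x ∷ []) (f x)

record Computable₂ (O : Set) (f : ℕ → ℕ → ℕ) : Set where
  constructor computes
  field
    code    : Code O 2
    correct : ∀ φ x y → Eval φ code (x ∷ y ∷ []) (f x y)

-- Closure under composition and primitive recursion

module _ {O : Set} where

  abs₁ : ∀ {f} → Computable O {1} f → Computable₁ O (λ x → f (x ∷ []))
  abs₁ (computes e ev) = computes e (λ φ x → ev φ (x ∷ []))

  abs₂ : ∀ {f} → Computable O {2} f → Computable₂ O (λ x y → f (x ∷ y ∷ []))
  abs₂ (computes e ev) = computes e (λ φ x y → ev φ (x ∷ y ∷ []))

  var : ∀ {n} (i : Fin n) → Computable O (λ xs → lookup xs i)
  var i = computes (proj i) (λ φ xs → ev-proj i)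

  app₁ : ∀ {n f} {g : Vec ℕ n → ℕ} → Computable₁ O f → Computable O g →
         Computable O (λ xs → f (g xs))
  app₁ (computes f f-ev) (computes g g-ev) =
    computes (comp f (g ∷ [])) (λ φ xs → ev-comp (g-ev φ xs ∷ []) (f-ev φ _))

  app₂ : ∀ {n f} {g h : Vec ℕ n → ℕ} → Computable₂ O f → Computable O g → Computable O h →
         Computable O (λ xs → f (g xs) (h xs))
  app₂ (computes f f-ev) (computes g g-ev) (computes h h-ev) =
    computes (comp f (g ∷ h ∷ []))
             (λ φ xs → ev-comp (g-ev φ xs ∷ h-ev φ xs ∷ []) (f-ev φ _ _))

  succ : Computable₁ O suc
  succ = computes sucᶜ (λ φ x → ev-suc)

  const : ∀ {n} k → Computable O {n} (λ _ → k)
  const zero    = computes (comp zeroᶜ []) (λ φ xs → ev-comp [] ev-zero)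
  const (suc k) = app₁ succ (const k)

  primRec₁ : ∀ {f g} → Computable O g → (∀ k → f (suc k) ≡ g (k ∷ f k ∷ [])) → Computable₁ O f
  primRec₁ {f} {g} (computes eᵍ evᵍ) step = computes e ev
    where
    base = const {0} (f 0)
    e = comp (rec (Computable.code base) eᵍ) (proj 0F ∷ [])
    ev-rec : ∀ φ x → Eval φ (rec (Computable.code base) eᵍ) (x ∷ []) (f x)
    ev-rec φ zero    = ev-rec0 (Computable.correct base φ [])
    ev-rec φ (suc x) = ev-recs (ev-rec φ x) (subst (Eval φ eᵍ _) (sym (step x)) (evᵍ φ _))
    ev : ∀ φ x → Eval φ e (x ∷ []) (f x)
    ev φ x = ev-comp (ev-proj 0F ∷ []) (ev-rec φ x)

  primRec₂ : ∀ {f g} → Computable₁ O (f 0) → Computable O g →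
             (∀ k x → f (suc k) x ≡ g (k ∷ f k x ∷ x ∷ [])) → Computable₂ O f
  primRec₂ {f} {g} (computes eᵇ evᵇ) (computes eᵍ evᵍ) step = computes (rec eᵇ eᵍ) ev
    where
    ev : ∀ φ k x → Eval φ (rec eᵇ eᵍ) (k ∷ x ∷ []) (f k x)
    ev φ zero    x = ev-rec0 (evᵇ φ x)
    ev φ (suc k) x = ev-recs (ev φ k x) (subst (Eval φ eᵍ _) (sym (step k x)) (evᵍ φ _))

  plus : Computable₂ O _+_
  plus = primRec₂ (abs₁ (var 0F)) (app₁ succ (var 1F)) (λ _ _ → refl)

  times : Computable₂ O _*_
  times = primRec₂ (abs₁ (const 0)) (app₂ plus (var 2F) (var 1F)) (λ _ _ → refl)

  predecessor : Computable₁ O pred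
  predecessor = primRec₁ (var 0F) (λ _ → refl)

  monus : Computable₂ O _∸_
  monus = abs₂ (app₂ flipped (var 1F) (var 0F))
    where
    flipped : Computable₂ O (λ y x → x ∸ y)
    flipped = primRec₂ (abs₁ (var 0F)) (app₁ predecessor (var 1F))
                       (λ y x → sym (pred[m∸n]≡m∸[1+n] x y))

  powerOf2 : Computable₁ O (2 ^_)
  powerOf2 = primRec₁ (app₂ times (const 2) (var 1F)) (λ _ → refl)

  iterated : ∀ {s} → Computable₁ O s → Computable₂ O (λ k x → fold x s k)
  iterated s = primRec₂ (abs₁ (var 0F)) (app₁ s (var 1F)) (λ _ _ → refl)

ifZero : ℕ → ℕ → ℕ → ℕ
ifZero zero    x y = x
ifZero (suc _) x y = y

conditional : ∀ {O n} {f g h : Vec ℕ n → ℕ} → Computable O f → Computable O g → Computable O h →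
              Computable O (λ xs → ifZero (f xs) (g xs) (h xs))
conditional {O} (computes f f-ev) (computes g g-ev) (computes h h-ev) =
  computes (comp branch (f ∷ g ∷ h ∷ []))
           (λ φ xs → ev-comp (f-ev φ xs ∷ g-ev φ xs ∷ h-ev φ xs ∷ []) (ev-branch φ _ _ _))
  where
  branch : Code O 3
  -- The step receives the counter, the previous value, `x` and `y`, in this order, and discards the
  -- previous value.
  branch = rec (proj 0F) (proj 3F)
  ev-branch : ∀ φ c x y → Eval φ branch (c ∷ x ∷ y ∷ []) (ifZero c x y)
  ev-branch φ zero          x y = ev-rec0 (ev-proj 0F)
  ev-branch φ (suc zero)    x y = ev-recs (ev-branch φ zero x y) (ev-proj 3F)
  ev-branch φ (suc (suc c)) x y = ev-recs (ev-branch φ (suc c) x y) (ev-proj 3F)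

-- Least zeros and unbounded search

IsLeastZero : (ℕ → ℕ) → ℕ → Set
IsLeastZero f m = f m ≡ 0 × (∀ j → j < m → f j ≢ 0)

leastZero : ∀ f k → f k ≡ 0 → ∃ (IsLeastZero f)
leastZero f zero    fk≡0 = 0 , fk≡0 , (λ _ ())
leastZero f (suc k) fk≡0 with f 0 ≟ 0
... | yes f0≡0 = 0 , f0≡0 , (λ _ ())
... | no  f0≢0 with m , fm≡0 , below ← leastZero (λ j → f (suc j)) k fk≡0 =
  suc m , fm≡0 , λ { zero _ → f0≢0 ; (suc j) (s≤s j<m) → below j j<m }

leastZero-unique : ∀ {f m n} → IsLeastZero f m → IsLeastZero f n → m ≡ n
leastZero-unique {m = m} {n} (fm≡0 , below-m) (fn≡0 , below-n) =
  ≤-antisym (≮⇒≥ λ n<m → below-m n n<m fn≡0) (≮⇒≥ λ m<n → below-n m m<n fm≡0)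

-- Every search is known to succeed, so `μ` yields a total function. The search variable comes first
-- in `f`, as in the scheme `μ`.
minimisation : ∀ {O f m} → Computable₂ O f → (∀ x → IsLeastZero (λ k → f k x) (m x)) →
               Computable₁ O m
minimisation {O} {f} {m} (computes e ev) isLeast = computes (μ e) ev-min
  where
  ev-min : ∀ φ x → Eval φ (μ e) (x ∷ []) (m x)
  ev-min φ x = ev-μ
    (λ j j<m → pred (f j x) , subst (Eval φ e _)
      (sym (suc-pred (f j x) {{≢-nonZero (proj₂ (isLeast x) j j<m)}})) (ev φ j x))
    (subst (Eval φ e _) (proj₁ (isLeast x)) (ev φ (m x) x))

-- Binary digits

odd : ℕ → Bool
odd zero    = false
odd (suc n) = not (odd n)

parity : ℕ → ℕ
parity n = bit (odd n)

-- This is `n` divided by `2 ^ k`, rounded down, so `parity (shift t x)` is the binary digit of `x`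
-- of weight `2 ^ t`.
shift : ℕ → ℕ → ℕ
shift k n = fold n ⌊_/2⌋ k

bit-not : ∀ b → bit (not b) ≡ 1 ∸ bit b
bit-not false = refl
bit-not true  = refl

-- The recursion equation through which halving becomes primitive recursive.
⌊1+n/2⌋ : ∀ n → ⌊ suc n /2⌋ ≡ ⌊ n /2⌋ + parity n
⌊1+n/2⌋ zero          = refl
⌊1+n/2⌋ (suc zero)    = refl
⌊1+n/2⌋ (suc (suc n)) = cong suc
  (trans (⌊1+n/2⌋ n) (cong (λ b → ⌊ n /2⌋ + bit b) (sym (not-involutive (odd n)))))

parity+2⌊n/2⌋ : ∀ n → parity n + 2 * ⌊ n /2⌋ ≡ n
parity+2⌊n/2⌋ zero          = refl
parity+2⌊n/2⌋ (suc zero)    = refl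
parity+2⌊n/2⌋ (suc (suc n)) = begin
  parity (2 + n) + 2 * suc ⌊ n /2⌋  ≡⟨ cong₂ _+_ (cong bit (not-involutive (odd n))) (*-suc 2 ⌊ n /2⌋) ⟩
  parity n + (2 + 2 * ⌊ n /2⌋)      ≡⟨ +-assoc (parity n) 2 _ ⟨
  parity n + 2 + 2 * ⌊ n /2⌋        ≡⟨ cong (_+ 2 * ⌊ n /2⌋) (+-comm (parity n) 2) ⟩
  2 + (parity n + 2 * ⌊ n /2⌋)      ≡⟨ cong (_+_ 2) (parity+2⌊n/2⌋ n) ⟩
  2 + n                             ∎
  where open ≡-Reasoning

odd-2* : ∀ n → odd (2 * n) ≡ false
odd-2* zero    = refl
odd-2* (suc n) = trans (cong (λ m → not (odd m)) (+-suc n (n + 0)))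
                       (trans (not-involutive (odd (2 * n))) (odd-2* n))

⌊2n/2⌋ : ∀ n → ⌊ 2 * n /2⌋ ≡ n
⌊2n/2⌋ n = trans (cong (λ m → ⌊ n + m /2⌋) (+-identityʳ n)) (sym (n≡⌊n+n/2⌋ n))

⌊1+2n/2⌋ : ∀ n → ⌊ 1 + 2 * n /2⌋ ≡ n
⌊1+2n/2⌋ n = trans (cong (λ m → ⌊ suc (n + m) /2⌋) (+-identityʳ n)) (sym (n≡⌈n+n/2⌉ n))

fold-suc : ∀ {A : Set} (z : A) s k → fold z s (suc k) ≡ fold (s z) s k
fold-suc z s k = trans (cong (fold z s) (+-comm 1 k)) (fold-+ z s k)

shift-2^ : ∀ k n → shift k (2 ^ k * n) ≡ n
shift-2^ zero    n = +-identityʳ n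
shift-2^ (suc k) n = begin
  shift (suc k) (2 * 2 ^ k * n)     ≡⟨ fold-suc (2 * 2 ^ k * n) ⌊_/2⌋ k ⟩
  shift k ⌊ 2 * 2 ^ k * n /2⌋       ≡⟨ cong (λ m → shift k ⌊ m /2⌋) (*-assoc 2 (2 ^ k) n) ⟩
  shift k ⌊ 2 * (2 ^ k * n) /2⌋     ≡⟨ cong (shift k) (⌊2n/2⌋ (2 ^ k * n)) ⟩
  shift k (2 ^ k * n)               ≡⟨ shift-2^ k n ⟩
  n                                 ∎
  where open ≡-Reasoning

2^k*shift≤ : ∀ k n → 2 ^ k * shift k n ≤ n
2^k*shift≤ zero    n = ≤-reflexive (+-identityʳ n)
2^k*shift≤ (suc k) n = begin
  2 * 2 ^ k * ⌊ shift k n /2⌋        ≡⟨ cong (_* ⌊ shift k n /2⌋) (*-comm 2 (2 ^ k)) ⟩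
  2 ^ k * 2 * ⌊ shift k n /2⌋        ≡⟨ *-assoc (2 ^ k) 2 _ ⟩
  2 ^ k * (2 * ⌊ shift k n /2⌋)      ≤⟨ *-monoʳ-≤ (2 ^ k) (m≤n+m _ (parity (shift k n))) ⟩
  2 ^ k * (parity (shift k n) + 2 * ⌊ shift k n /2⌋)  ≡⟨ cong (2 ^ k *_) (parity+2⌊n/2⌋ (shift k n)) ⟩
  2 ^ k * shift k n                  ≤⟨ 2^k*shift≤ k n ⟩
  n                                  ∎
  where open ≤-Reasoning

n<2^n : ∀ n → n < 2 ^ n
n<2^n zero    = s≤s z≤n
n<2^n (suc n) = begin
  suc (suc n)    ≡⟨ +-comm 1 (suc n) ⟩
  suc n + 1      ≤⟨ +-mono-≤ (n<2^n n) (≤-trans (m^n>0 2 n) (m≤m+n (2 ^ n) 0)) ⟩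
  2 * 2 ^ n      ∎
  where open ≤-Reasoning

-- The second factor only makes the search stop at z = 0.
notValuation : ℕ → ℕ → ℕ
notValuation e z = (1 ∸ parity (shift e z)) * (z ∸ e)

valuation : ∀ z → ∃ (IsLeastZero (λ e → notValuation e z))
valuation z = leastZero _ z
  (trans (cong ((1 ∸ parity (shift z z)) *_) (n∸n≡0 z)) (*-zeroʳ (1 ∸ parity (shift z z))))

-- For positive `z` this is the exponent of 2 in `z`; `π₂` then recovers `x` from the odd part
-- `1 + 2 * x`.
π₁ : ℕ → ℕ
π₁ z = proj₁ (valuation z)

π₂ : ℕ → ℕ
π₂ z = ⌊ shift (π₁ z) z /2⌋

shift-2^+ : ∀ j d n → shift j (2 ^ (d + j) * n) ≡ 2 ^ d * n
shift-2^+ j d n = trans (cong (shift j) eq) (shift-2^ j (2 ^ d * n))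
  where
  eq : 2 ^ (d + j) * n ≡ 2 ^ j * (2 ^ d * n)
  eq = trans (cong (λ m → 2 ^ m * n) (+-comm d j))
             (trans (cong (_* n) (^-distribˡ-+-* 2 j d)) (*-assoc (2 ^ j) (2 ^ d) n))

opaque

  -- For fixed `e` this pairing is linear in `x`. With `x` the code of a program of length `k`, the
  -- pair stays within a constant multiple of `2 ^ k`, which is what the growth of `r` allows; a
  -- quadratic pairing would be too large.
  ⟪_,_⟫ : ℕ → ℕ → ℕ
  ⟪ e , x ⟫ = 2 ^ e * (1 + 2 * x)

  ⟪⟫-def : ∀ e x → ⟪ e , x ⟫ ≡ 2 ^ e * (1 + 2 * x)
  ⟪⟫-def e x = refl

  e<⟪e,x⟫ : ∀ e x → e < ⟪ e , x ⟫
  e<⟪e,x⟫ e x = ≤-trans (n<2^n e) (m≤m*n (2 ^ e) (1 + 2 * x))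

  x<⟪e,x⟫ : ∀ e x → x < ⟪ e , x ⟫
  x<⟪e,x⟫ e x = ≤-trans (s≤s (m≤m+n x (x + 0))) (m≤n*m (1 + 2 * x) (2 ^ e) {{m^n≢0 2 e}})

  -- Shifting by `e` leaves the odd number `1 + 2 * x`. Shifting by `j < e` leaves an even number,
  -- and `j` is below the pair, so neither factor of `notValuation` vanishes.
  ⟪⟫-valuation : ∀ e x → IsLeastZero (λ j → notValuation j ⟪ e , x ⟫) e
  ⟪⟫-valuation e x = at , below
    where
    at : notValuation e ⟪ e , x ⟫ ≡ 0
    at = cong (_* (⟪ e , x ⟫ ∸ e)) (trans
      (cong (λ m → 1 ∸ parity m) (shift-2^ e (1 + 2 * x)))
      (cong (λ b → 1 ∸ bit (not b)) (odd-2* x)))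
    below : ∀ j → j < e → notValuation j ⟪ e , x ⟫ ≢ 0
    below j j<e eq = <⇒≢ (m<n⇒0<n∸m (<-trans j<e (e<⟪e,x⟫ e x))) (sym (begin
      ⟪ e , x ⟫ ∸ j                 ≡⟨ +-identityʳ _ ⟨
      1 * (⟪ e , x ⟫ ∸ j)           ≡⟨ cong (λ b → (1 ∸ bit b) * (⟪ e , x ⟫ ∸ j)) even ⟨
      notValuation j ⟪ e , x ⟫      ≡⟨ eq ⟩
      0                             ∎))
      where
      open ≡-Reasoning
      d : ℕ
      d = e ∸ suc j
      even : odd (shift j ⟪ e , x ⟫) ≡ false
      even = begin
        odd (shift j (2 ^ e * (1 + 2 * x)))
          ≡⟨ cong (λ k → odd (shift j (2 ^ k * (1 + 2 * x)))) (trans (sym (m∸n+n≡m j<e)) (+-suc d j)) ⟩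
        odd (shift j (2 ^ (suc d + j) * (1 + 2 * x)))
          ≡⟨ cong odd (shift-2^+ j (suc d) (1 + 2 * x)) ⟩
        odd (2 * 2 ^ d * (1 + 2 * x))
          ≡⟨ cong odd (*-assoc 2 (2 ^ d) (1 + 2 * x)) ⟩
        odd (2 * (2 ^ d * (1 + 2 * x)))
          ≡⟨ odd-2* (2 ^ d * (1 + 2 * x)) ⟩
        false ∎

  π₁-⟪⟫ : ∀ e x → π₁ ⟪ e , x ⟫ ≡ e
  π₁-⟪⟫ e x = leastZero-unique (proj₂ (valuation ⟪ e , x ⟫)) (⟪⟫-valuation e x)

  π₂-⟪⟫ : ∀ e x → π₂ ⟪ e , x ⟫ ≡ x
  π₂-⟪⟫ e x = trans (cong (λ j → ⌊ shift j ⟪ e , x ⟫ /2⌋) (π₁-⟪⟫ e x))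
                    (trans (cong ⌊_/2⌋ (shift-2^ e (1 + 2 * x))) (⌊1+2n/2⌋ x))

-- Reading blocks off the code of a string

-- The head of a string is the least significant digit of its code, 1 for `false` and 2 for `true`.
-- Hence predecessor and halving remove it, and the parity of the successor is its bit.
tailᶜ : ℕ → ℕ
tailᶜ u = ⌊ pred u /2⌋

dropᶜ : ℕ → ℕ → ℕ
dropᶜ k u = fold u tailᶜ k

headᶜ : ℕ → ℕ
headᶜ u = parity (suc u)

readBinary : ℕ → ℕ → ℕ
readBinary zero    u = 0
readBinary (suc w) u = readBinary w u + 2 ^ w * headᶜ (dropᶜ w u)

tailᶜ-∷ : ∀ b σ → tailᶜ ⌜ b ∷ σ ⌝ ≡ ⌜ σ ⌝
tailᶜ-∷ false σ = ⌊2n/2⌋ ⌜ σ ⌝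
tailᶜ-∷ true  σ = ⌊1+2n/2⌋ ⌜ σ ⌝

headᶜ-∷ : ∀ b σ → headᶜ ⌜ b ∷ σ ⌝ ≡ bit b
headᶜ-∷ false σ = cong (λ b → bit (not (not b))) (odd-2* ⌜ σ ⌝)
headᶜ-∷ true  σ = cong (λ b → bit (not (not (not b)))) (odd-2* ⌜ σ ⌝)

headᶜ-dropᶜ : ∀ (f : ℕ → Bool) {m n} → m < n → headᶜ (dropᶜ m ⌜ applyUpTo f n ⌝) ≡ bit (f m)
headᶜ-dropᶜ f {zero}  {suc n} m<n = headᶜ-∷ (f 0) _
headᶜ-dropᶜ f {suc m} {suc n} (s≤s m<n) = begin
  headᶜ (dropᶜ (suc m) ⌜ f 0 ∷ fs ⌝)      ≡⟨ cong headᶜ (fold-suc ⌜ f 0 ∷ fs ⌝ tailᶜ m) ⟩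
  headᶜ (dropᶜ m (tailᶜ ⌜ f 0 ∷ fs ⌝))    ≡⟨ cong (λ u → headᶜ (dropᶜ m u)) (tailᶜ-∷ (f 0) fs) ⟩
  headᶜ (dropᶜ m ⌜ fs ⌝)                  ≡⟨ headᶜ-dropᶜ (λ i → f (suc i)) m<n ⟩
  bit (f (suc m))                         ∎
  where
  open ≡-Reasoning
  fs = applyUpTo (λ i → f (suc i)) n

-- Without a bound on `x` the induction goes through: the digits read so far and the unread quotient
-- always make up `x`.
readBinary-shift : ∀ {u x} w → (∀ t → t < w → headᶜ (dropᶜ t u) ≡ parity (shift t x)) →
                   readBinary w u + 2 ^ w * shift w x ≡ x
readBinary-shift {x = x} zero eq = +-identityʳ x
readBinary-shift {u} {x} (suc w) eq = begin
  r + 2 ^ w * headᶜ (dropᶜ w u) + 2 * 2 ^ w * ⌊ s /2⌋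
    ≡⟨ +-assoc r _ _ ⟩
  r + (2 ^ w * headᶜ (dropᶜ w u) + 2 * 2 ^ w * ⌊ s /2⌋)
    ≡⟨ cong (_+_ r) (cong₂ _+_ (cong (2 ^ w *_) (eq w ≤-refl))
         (trans (cong (_* ⌊ s /2⌋) (*-comm 2 (2 ^ w))) (*-assoc (2 ^ w) 2 ⌊ s /2⌋))) ⟩
  r + (2 ^ w * parity s + 2 ^ w * (2 * ⌊ s /2⌋))
    ≡⟨ cong (_+_ r) (*-distribˡ-+ (2 ^ w) (parity s) (2 * ⌊ s /2⌋)) ⟨
  r + 2 ^ w * (parity s + 2 * ⌊ s /2⌋)
    ≡⟨ cong (λ m → r + 2 ^ w * m) (parity+2⌊n/2⌋ s) ⟩
  r + 2 ^ w * s
    ≡⟨ readBinary-shift w (λ t t<w → eq t (m≤n⇒m≤1+n t<w)) ⟩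
  x ∎
  where
  open ≡-Reasoning
  r = readBinary w u
  s = shift w x

readBinary-correct : ∀ {u x} w → x < 2 ^ w →
                     (∀ t → t < w → headᶜ (dropᶜ t u) ≡ parity (shift t x)) → readBinary w u ≡ x
readBinary-correct {u} {x} w x<2^w eq = begin
  readBinary w u                         ≡⟨ +-identityʳ _ ⟨
  readBinary w u + 0                     ≡⟨ cong (_+_ (readBinary w u)) (trans (cong (2 ^ w *_) s≡0) (*-zeroʳ (2 ^ w))) ⟨
  readBinary w u + 2 ^ w * shift w x     ≡⟨ readBinary-shift w eq ⟩
  x                                      ∎
  where
  open ≡-Reasoning
  s≡0 : shift w x ≡ 0
  s≡0 = n<1⇒n≡0 (*-cancelˡ-< (2 ^ w) (shift w x) 1
    (≤-<-trans (2^k*shift≤ w x) (<-≤-trans x<2^w (≤-reflexive (sym (*-identityʳ (2 ^ w)))))))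

-- The summand 2 lets the induction close, as `2 + (2 + 2 * c)` equals `2 * (2 + c)`.
2+⌜⌝≤2^1+length : ∀ σ → 2 + ⌜ σ ⌝ ≤ 2 ^ suc (length σ)
2+⌜⌝≤2^1+length []      = s≤s (s≤s z≤n)
2+⌜⌝≤2^1+length (b ∷ σ) = begin
  2 + ⌜ b ∷ σ ⌝              ≤⟨ +-monoʳ-≤ 2 (digit b) ⟩
  2 + (2 + 2 * ⌜ σ ⌝)        ≡⟨ cong (_+_ 2) (*-suc 2 ⌜ σ ⌝) ⟨
  2 + 2 * (1 + ⌜ σ ⌝)        ≡⟨ *-suc 2 (1 + ⌜ σ ⌝) ⟨
  2 * (2 + ⌜ σ ⌝)            ≤⟨ *-monoʳ-≤ 2 (2+⌜⌝≤2^1+length σ) ⟩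
  2 * 2 ^ suc (length σ)     ∎
  where
  open ≤-Reasoning
  digit : ∀ b → ⌜ b ∷ σ ⌝ ≤ 2 + 2 * ⌜ σ ⌝
  digit false = n≤1+n _
  digit true  = ≤-refl

-- Computability of digits, pairing and block reading

module _ {O : Set} where

  parity-computable : Computable₁ O parity
  parity-computable =
    primRec₁ (app₂ monus (const 1) (var 1F)) (λ k → bit-not (odd k))

  half-computable : Computable₁ O ⌊_/2⌋
  half-computable = primRec₁ (app₂ plus (var 1F) (app₁ parity-computable (var 0F))) ⌊1+n/2⌋

  shift-computable : Computable₂ O shift
  shift-computable = iterated half-computable

  π₁-computable : Computable₁ O π₁
  π₁-computable = minimisation
    (abs₂ (app₂ times (app₂ monus (const 1) (app₁ parity-computable (app₂ shift-computable (var 0F) (var 1F))))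
                      (app₂ monus (var 1F) (var 0F))))
    (λ z → proj₂ (valuation z))

  π₂-computable : Computable₁ O π₂
  π₂-computable = abs₁ (app₁ half-computable
    (app₂ shift-computable (app₁ π₁-computable (var 0F)) (var 0F)))

  dropᶜ-computable : Computable₂ O dropᶜ
  dropᶜ-computable = iterated (abs₁ (app₁ half-computable (app₁ predecessor (var 0F))))

  readBinary-computable : Computable₂ O readBinary
  readBinary-computable = primRec₂ (abs₁ (const 0))
    (app₂ plus (var 1F) (app₂ times (app₁ powerOf2 (var 0F))
      (app₁ parity-computable (app₁ succ (app₂ dropᶜ-computable (var 0F) (var 2F))))))
    (λ _ _ → refl)

-- Block layout

module Layout (v : ℕ → ℕ) (v→∞ : ∀ M → ∃ λ T → ∀ i → T ≤ i → M ≤ v i) where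

  -- The number of indices from i on that are coded before the next one is skipped.
  credit : ℕ → ℕ
  credit zero    = 0
  credit (suc i) = ifZero (credit i) ⌊ v i /2⌋ (pred (credit i))

  -- The position in the concatenated sequence at which block `i` starts. An index with credit 0 is
  -- skipped, that is, it gets an empty block.
  origin : ℕ → ℕ
  origin zero    = 0
  origin (suc i) = origin i + ifZero (credit i) 0 (2 + v i)

  origin-suc : ∀ i → credit i ≢ 0 → origin (suc i) ≡ origin i + (2 + v i)
  origin-suc i coded with credit i
  ... | zero  = contradiction refl coded
  ... | suc _ = refl

  -- An amortised count in which each unit of credit stands for two saved bits. A coded index
  -- overspends its budget `v i` by two bits and pays with one credit; a skipped index turns its
  -- whole budget into credit, up to rounding.
  origin+2credit≤ : ∀ {ℓ} → (∀ i → v i ≤ ℓ i) → ∀ i →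
                    origin i + 2 * credit i ≤ sum (applyUpTo ℓ i)
  origin+2credit≤ {ℓ} v≤ℓ zero = z≤n
  origin+2credit≤ {ℓ} v≤ℓ (suc i) = begin
    origin (suc i) + 2 * credit (suc i)     ≤⟨ step (origin i) (credit i) ⟩
    origin i + 2 * credit i + v i           ≤⟨ +-mono-≤ (origin+2credit≤ v≤ℓ i) (v≤ℓ i) ⟩
    sum (applyUpTo ℓ i) + ℓ i               ≡⟨ cong (_+_ (sum (applyUpTo ℓ i))) (+-identityʳ (ℓ i)) ⟨
    sum (applyUpTo ℓ i) + (ℓ i + 0)         ≡⟨ sum-++ (applyUpTo ℓ i) _ ⟨
    sum (applyUpTo ℓ i ∷ʳ ℓ i)              ≡⟨ cong sum (applyUpTo-∷ʳ ℓ i) ⟩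
    sum (applyUpTo ℓ (suc i))               ∎
    where
    open ≤-Reasoning
    step : ∀ s c → s + ifZero c 0 (2 + v i) + 2 * ifZero c ⌊ v i /2⌋ (pred c) ≤ s + 2 * c + v i
    step s zero    = +-monoʳ-≤ (s + 0)
      (≤-trans (m≤n+m _ (parity (v i))) (≤-reflexive (parity+2⌊n/2⌋ (v i))))
    step s (suc c) = ≤-reflexive
      (solve 3 (λ s v c → s :+ (con 2 :+ v) :+ con 2 :* c := s :+ con 2 :* (con 1 :+ c) :+ v)
             refl s (v i) c)

  credit-decrease : ∀ t {j} → t < credit j → 0 < credit (t + j)
  credit-decrease zero        t<c = t<c
  credit-decrease (suc t) {j} t<c =
    subst (λ i → 0 < credit i) (+-suc t j) (credit-decrease t (step (credit j) t<c))
    where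
    step : ∀ c → suc t < c → t < ifZero c ⌊ v j /2⌋ (pred c)
    step (suc c) (s≤s t<c) = t<c

  -- The skip at `i` refills the credit to at least `suc a`, and each coded index takes only one
  -- unit, so some credit remains at `suc a + i`.
  next-coded : ∀ a i → credit i ≡ 0 → 2 * suc a ≤ v i → credit (suc a + i) ≢ 0
  next-coded a i skipped 2a≤v eq = n≮0 (subst (0 <_) (trans (cong credit (+-suc a i)) eq)
    (credit-decrease a (subst (a <_) (sym refill) a<half)))
    where
    refill : credit (suc i) ≡ ⌊ v i /2⌋
    refill = cong (λ c → ifZero c ⌊ v i /2⌋ (pred c)) skipped
    a<half : a < ⌊ v i /2⌋
    a<half = ≤-trans (≤-reflexive (sym (⌊2n/2⌋ (suc a)))) (⌊n/2⌋-mono 2a≤v)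

  origin-mono : ∀ {i j} → i ≤ j → origin i ≤ origin j
  origin-mono {i} i≤j = go (≤⇒≤′ i≤j)
    where
    go : ∀ {j} → i ≤′ j → origin i ≤ origin j
    go ≤′-refl       = ≤-refl
    go (≤′-step i≤j) = ≤-trans (go i≤j) (m≤m+n _ _)

  origin<origin+ : ∀ i → credit i ≢ 0 → origin i < origin (suc i)
  origin<origin+ i coded = subst (origin i <_) (sym (origin-suc i coded)) (m<m+n (origin i) z<s)

  -- From `T` on `v` is at least 2, so a skipped index is followed by a coded one and `origin` grows
  -- at least once in two steps.
  origin-unbounded : ∀ n → ∃ λ i → n < origin (suc i)
  origin-unbounded n = let i , _ , n≤ = go (suc n) in i , ≤-trans n≤ (m≤m+n _ _)
    where
    T = proj₁ (v→∞ 2)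
    go : ∀ n → ∃ λ i → T ≤ i × n ≤ origin i
    go zero = T , ≤-refl , z≤n
    go (suc n) with i , T≤i , n≤ ← go n with credit i ≟ 0
    ... | no coded    = suc i , m≤n⇒m≤1+n T≤i , ≤-<-trans n≤ (origin<origin+ i coded)
    ... | yes skipped = 2 + i , m≤n⇒m≤1+n (m≤n⇒m≤1+n T≤i) ,
      ≤-<-trans (≤-trans n≤ (m≤m+n _ _))
                (origin<origin+ (suc i) (next-coded 0 i skipped (proj₂ (v→∞ 2) i T≤i)))

  -- Skipped blocks are empty, so the least `i` whose block ends after position `n` is a coded index
  -- whose block contains `n`.
  blockSearch : ∀ n → ∃ (IsLeastZero (λ i → suc n ∸ origin (suc i)))
  blockSearch n with i , n< ← origin-unbounded n = leastZero _ i (m≤n⇒m∸n≡0 n<)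

  block : ℕ → ℕ
  block n = proj₁ (blockSearch n)

  block-origin : ∀ i t → credit i ≢ 0 → t < 2 + v i → block (origin i + t) ≡ i
  block-origin i t coded t<w = leastZero-unique (proj₂ (blockSearch (origin i + t)))
    ( m≤n⇒m∸n≡0 (subst (origin i + t <_) (sym (origin-suc i coded)) (+-monoʳ-< (origin i) t<w))
    , λ j j<i eq → <⇒≱ (m∸n≡0⇒m≤n eq) (≤-trans (origin-mono j<i) (m≤m+n (origin i) t)) )

  offset : ℕ → ℕ
  offset n = n ∸ origin (block n)

  concatenation : (ℕ → ℕ) → ℕ → Bool
  concatenation X n = odd (shift (offset n) (X (block n)))

  concatenation-block : ∀ X i t → credit i ≢ 0 → t < 2 + v i →
                        bit (concatenation X (origin i + t)) ≡ parity (shift t (X i))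
  concatenation-block X i t coded t<w
    rewrite block-origin i t coded t<w | m+n∸m≡n (origin i) t = refl

  decode : ℕ → ℕ → ℕ
  decode i u = readBinary (2 + v i) (dropᶜ (origin i) u)

  decode-concatenation : ∀ X i {n} → credit i ≢ 0 → X i < 2 ^ (2 + v i) → origin (suc i) ≤ n →
                         decode i ⌜ applyUpTo (concatenation X) n ⌝ ≡ X i
  decode-concatenation X i {n} coded X<2^w origin≤n = readBinary-correct (2 + v i) X<2^w digits
    where
    open ≡-Reasoning
    digits : ∀ t → t < 2 + v i →
             headᶜ (dropᶜ t (dropᶜ (origin i) ⌜ applyUpTo (concatenation X) n ⌝)) ≡ parity (shift t (X i))
    digits t t<w = begin
      headᶜ (dropᶜ t (dropᶜ (origin i) ⌜ applyUpTo (concatenation X) n ⌝))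
        ≡⟨ cong headᶜ (fold-+ _ tailᶜ t) ⟨
      headᶜ (dropᶜ (t + origin i) ⌜ applyUpTo (concatenation X) n ⌝)
        ≡⟨ cong (λ m → headᶜ (dropᶜ m ⌜ applyUpTo (concatenation X) n ⌝)) (+-comm t (origin i)) ⟩
      headᶜ (dropᶜ (origin i + t) ⌜ applyUpTo (concatenation X) n ⌝)
        ≡⟨ headᶜ-dropᶜ (concatenation X) (<-≤-trans (+-monoʳ-< (origin i) t<w)
             (subst (_≤ n) (origin-suc i coded) origin≤n)) ⟩
      bit (concatenation X (origin i + t))
        ≡⟨ concatenation-block X i t coded t<w ⟩
      parity (shift t (X i)) ∎

  -- Computability of the layout and the functional

  module _ (v-computable : ∀ {O} → Computable₁ O v) {O : Set} where

    credit-computable : Computable₁ O credit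
    credit-computable = primRec₁
      (conditional (var 1F) (app₁ half-computable (app₁ v-computable (var 0F))) (app₁ predecessor (var 1F)))
      (λ _ → refl)

    width : Computable₁ O (λ i → 2 + v i)
    width = abs₁ (app₁ succ (app₁ succ (app₁ v-computable (var 0F))))

    origin-computable : Computable₁ O origin
    origin-computable = primRec₁
      (app₂ plus (var 1F) (conditional (app₁ credit-computable (var 0F)) (const 0) (app₁ width (var 0F))))
      (λ _ → refl)

    block-computable : Computable₁ O block
    block-computable = minimisation
      (abs₂ (app₂ monus (app₁ succ (var 1F)) (app₁ origin-computable (app₁ succ (var 0F)))))
      (λ n → proj₂ (blockSearch n))

    offset-computable : Computable₁ O offset
    offset-computable = abs₁ (app₂ monus (var 0F) (app₁ origin-computable (app₁ block-computable (var 0F))))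

    decode-computable : Computable₂ O decode
    decode-computable = abs₂ (app₂ readBinary-computable (app₁ width (var 0F))
      (app₂ dropᶜ-computable (app₁ origin-computable (var 0F)) (var 1F)))

  -- One query to the oracle, at `block n`, determines bit `n`.
  concatenator : (∀ {O} → Computable₁ O v) → Functional
  concatenator v-computable =
    comp (Computable₂.code (abs₂ (app₁ parity-computable (app₂ shift-computable (var 0F) (var 1F)))))
         ( Computable₁.code (offset-computable v-computable)
         ∷ comp (oracle _) (Computable₁.code (block-computable v-computable) ∷ [])
         ∷ [])

  concatenator-correct : ∀ (v-computable : ∀ {O} → Computable₁ O v) X n →
                         concatenator v-computable ⟪ X ⟫ n ⇓ bit (concatenation X n)
  concatenator-correct v-computable X n =
    ev-comp ( Computable₁.correct (offset-computable v-computable) _ n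
            ∷ ev-comp (Computable₁.correct (block-computable v-computable) _ n ∷ []) ev-oracle
            ∷ [])
            (Computable₂.correct (abs₂ (app₁ parity-computable (app₂ shift-computable (var 0F) (var 1F)))) _ _ _)

-- Comparisons of reals and rationals

fraction : ℕ → ℕ → ℕ → ℚ
fraction a b d = (a ℤ.⊖ b) / suc d

toℚᵘ-/ : ∀ i d → toℚᵘ (i / suc d) ℚᵘ.≃ mkℚᵘ i d
toℚᵘ-/ i d = ℚₚ.toℚᵘ-fromℚᵘ (mkℚᵘ i d)

-- Clearing the denominator and moving `b` across turns a comparison of rationals into one of
-- natural numbers, which a recursive search can decide.
ℕ<fraction+ℕ : ∀ x y a b d → + x / 1 ℚ.< fraction a b d ℚ.+ + y / 1 →
               x * suc d + b < a + y * suc d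
ℕ<fraction+ℕ x y a b d x<q+y
  with ℚᵘ.*<* lt ← ℚᵘₚ.<-respˡ-≃ (toℚᵘ-/ (+ x) 0) (ℚᵘₚ.<-respʳ-≃
         (ℚᵘₚ.≃-trans (ℚₚ.toℚᵘ-homo-+ (fraction a b d) (+ y / 1))
                      (ℚᵘₚ.+-cong (toℚᵘ-/ (a ℤ.⊖ b) d) (toℚᵘ-/ (+ y) 0)))
         (ℚₚ.toℚᵘ-mono-< x<q+y))
  = ℤₚ.drop‿+<+ (begin-strict
  + (x * suc d + b)
    ≡⟨ cong (ℤ._+ + b) (ℤₚ.pos-* x (suc d)) ⟩
  + x ℤ.* + suc d ℤ.+ + b
    ≡⟨ cong (λ m → + x ℤ.* + m ℤ.+ + b) (*-identityʳ (suc d)) ⟨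
  + x ℤ.* + (suc d * 1) ℤ.+ + b
    <⟨ ℤₚ.+-monoˡ-< (+ b) lt ⟩
  ((a ℤ.⊖ b) ℤ.* + 1 ℤ.+ + y ℤ.* + suc d) ℤ.* + 1 ℤ.+ + b
    ≡⟨ cong (λ z → (z ℤ.* + 1 ℤ.+ + y ℤ.* + suc d) ℤ.* + 1 ℤ.+ + b) (ℤₚ.m-n≡m⊖n a b) ⟨
  ((+ a ℤ.- + b) ℤ.* + 1 ℤ.+ + y ℤ.* + suc d) ℤ.* + 1 ℤ.+ + b
    ≡⟨ S.solve 4 (λ a b y e → ((a S.:- b) S.:* S.con (+ 1) S.:+ y S.:* e) S.:* S.con (+ 1) S.:+ b
                         S.:= a S.:+ y S.:* e) refl (+ a) (+ b) (+ y) (+ suc d) ⟩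
  + a ℤ.+ + y ℤ.* + suc d
    ≡⟨ cong (ℤ._+_ (+ a)) (ℤₚ.pos-* y (suc d)) ⟨
  + (a + y * suc d) ∎)
  where
  open ℤₚ.≤-Reasoning
  module S = ℤ-Solver.+-*-Solver

fraction-1<ℕ : ∀ x a b d → fraction a b d ℚ.- 1ℚ ℚ.< + x / 1 → a < (x + 1) * suc d + b
fraction-1<ℕ x a b d q-1<x
  with ℚᵘ.*<* lt ← ℚᵘₚ.<-respʳ-≃ (toℚᵘ-/ (+ x) 0) (ℚᵘₚ.<-respˡ-≃
         (ℚᵘₚ.≃-trans (ℚₚ.toℚᵘ-homo-+ (fraction a b d) (ℚ.- 1ℚ))
                      (ℚᵘₚ.+-congˡ (toℚᵘ (ℚ.- 1ℚ)) (toℚᵘ-/ (a ℤ.⊖ b) d)))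
         (ℚₚ.toℚᵘ-mono-< q-1<x))
  = ℤₚ.drop‿+<+ (begin-strict
  + a
    ≡⟨ S.solve 3 (λ a b e → a S.:= ((a S.:- b) S.:* S.con (+ 1) S.:+ S.con (ℤ.-[1+ 0 ]) S.:* e) S.:* S.con (+ 1) S.:+ (e S.:+ b))
         refl (+ a) (+ b) (+ suc d) ⟩
  ((+ a ℤ.- + b) ℤ.* + 1 ℤ.+ ℤ.-[1+ 0 ] ℤ.* + suc d) ℤ.* + 1 ℤ.+ (+ suc d ℤ.+ + b)
    ≡⟨ cong (λ z → (z ℤ.* + 1 ℤ.+ ℤ.-[1+ 0 ] ℤ.* + suc d) ℤ.* + 1 ℤ.+ (+ suc d ℤ.+ + b)) (ℤₚ.m-n≡m⊖n a b) ⟩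
  ((a ℤ.⊖ b) ℤ.* + 1 ℤ.+ ℤ.-[1+ 0 ] ℤ.* + suc d) ℤ.* + 1 ℤ.+ (+ suc d ℤ.+ + b)
    <⟨ ℤₚ.+-monoˡ-< (+ suc d ℤ.+ + b) lt ⟩
  + x ℤ.* + (suc d * 1) ℤ.+ (+ suc d ℤ.+ + b)
    ≡⟨ cong (ℤ._+ (+ suc d ℤ.+ + b)) (ℤₚ.pos-* x (suc d * 1)) ⟨
  + (x * (suc d * 1) + (suc d + b))
    ≡⟨ cong +_ (solve 3 (λ x e b → x :* (e :* con 1) :+ (e :+ b) := (x :+ con 1) :* e :+ b) refl x (suc d) b) ⟩
  + ((x + 1) * suc d + b) ∎)
  where
  open ℤₚ.≤-Reasoning
  module S = ℤ-Solver.+-*-Solver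

+-cancelʳ-<ℚ : ∀ r {p q} → p ℚ.+ r ℚ.< q ℚ.+ r → p ℚ.< q
+-cancelʳ-<ℚ r p+r<q+r = ℚₚ.≰⇒> λ q≤p → ℚₚ.<-irrefl refl (ℚₚ.<-≤-trans p+r<q+r (ℚₚ.+-monoˡ-≤ r q≤p))

/1-mono-≤ : ∀ {x y} → x ≤ y → + x / 1 ℚ.≤ + y / 1
/1-mono-≤ {x} {y} x≤y = ℚₚ.toℚᵘ-cancel-≤ (ℚᵘₚ.≤-respˡ-≃ (ℚᵘₚ.≃-sym (toℚᵘ-/ (+ x) 0))
  (ℚᵘₚ.≤-respʳ-≃ (ℚᵘₚ.≃-sym (toℚᵘ-/ (+ y) 0)) (ℚᵘ.*≤* (ℤₚ.*-monoʳ-≤-nonNeg (+ 1) (ℤ.+≤+ x≤y)))))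

0≤2^- : ∀ k → ℚ.0ℚ ℚ.≤ 2^- k
0≤2^- k = ℚₚ.nonNegative⁻¹ (2^- k) {{2^-nonNeg k}}

2^-≤1 : ∀ k → 2^- k ℚ.≤ 1ℚ
2^-≤1 zero    = ℚₚ.≤-refl
2^-≤1 (suc k) = ℚₚ.≤-trans (ℚₚ.*-monoˡ-≤-nonNeg ½ (2^-≤1 k)) (ℚₚ.≤ᵇ⇒≤ _)

q-ε≤q : ∀ q {ε} → ℚ.0ℚ ℚ.≤ ε → q ℚ.- ε ℚ.≤ q
q-ε≤q q {ε} 0≤ε = subst (q ℚ.- ε ℚ.≤_) (ℚₚ.+-identityʳ q) (ℚₚ.+-monoʳ-≤ q (ℚₚ.neg-antimono-≤ 0≤ε))

q≤q+ε : ∀ q {ε} → ℚ.0ℚ ℚ.≤ ε → q ℚ.≤ q ℚ.+ ε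
q≤q+ε q {ε} 0≤ε = subst (ℚ._≤ q ℚ.+ ε) (ℚₚ.+-identityʳ q) (ℚₚ.+-monoʳ-≤ q 0≤ε)

fromℚ-mono-≤ : ∀ {s t} → s ℚ.≤ t → fromℚ s ≤ᴿ fromℚ t
fromℚ-mono-≤ {s} {t} s≤t k =
  ℚₚ.≤-trans (q-ε≤q s (0≤2^- k)) (ℚₚ.≤-trans s≤t (q≤q+ε t (0≤2^- k)))

fromℕ-mono-≤ : ∀ {x y} → x ≤ y → fromℕ x ≤ᴿ fromℕ y
fromℕ-mono-≤ x≤y = fromℚ-mono-≤ (/1-mono-≤ x≤y)

-- The strict inequality supplies a precision `k`. Evaluating the weak one at the same `k` leaves
-- the error `2^- k` on both sides, where it cancels.
fromℚ<x≤fromℚ : ∀ s t x → fromℚ s <ᴿ x → x ≤ᴿ fromℚ t → s ℚ.< t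
fromℚ<x≤fromℚ s t x (k , s<x) x≤t = +-cancelʳ-<ℚ (2^- k) (ℚₚ.<-≤-trans s<x (x≤t k))

fromℚ≤x<fromℚ : ∀ s t x → fromℚ s ≤ᴿ x → x <ᴿ fromℚ t → s ℚ.< t
fromℚ≤x<fromℚ s t x s≤x (k , x<t) = +-cancelʳ-<ℚ (ℚ.- 2^- k) (ℚₚ.≤-<-trans (s≤x k) x<t)

-- Composing ≤ᴿ through an unknown approximation costs twice its error.
fromℚ<x≤y≤fromℚ : ∀ s t x y → fromℚ s <ᴿ x → x ≤ᴿ y → y ≤ᴿ fromℚ t → s ℚ.< t ℚ.+ (1ℚ ℚ.+ 1ℚ)
fromℚ<x≤y≤fromℚ s t x y (k , s<x) x≤y y≤t = begin-strict
  s                                          <⟨ +-cancelʳ-<ℚ (2^- k) (ℚₚ.<-≤-trans s<x (x≤y k)) ⟩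
  approx y k                                 ≡⟨ ℚₚ.+-identityʳ _ ⟨
  approx y k ℚ.+ ℚ.0ℚ                        ≡⟨ cong (approx y k ℚ.+_) (ℚₚ.+-inverseˡ (2^- k)) ⟨
  approx y k ℚ.+ (ℚ.- 2^- k ℚ.+ 2^- k)       ≡⟨ ℚₚ.+-assoc (approx y k) _ _ ⟨
  approx y k ℚ.- 2^- k ℚ.+ 2^- k             ≤⟨ ℚₚ.+-monoˡ-≤ (2^- k) (y≤t k) ⟩
  t ℚ.+ 2^- k ℚ.+ 2^- k                      ≡⟨ ℚₚ.+-assoc t _ _ ⟩
  t ℚ.+ (2^- k ℚ.+ 2^- k)                    ≤⟨ ℚₚ.+-monoʳ-≤ t (ℚₚ.+-mono-≤ (2^-≤1 k) (2^-≤1 k)) ⟩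
  t ℚ.+ (1ℚ ℚ.+ 1ℚ)                          ∎
  where open ℚₚ.≤-Reasoning

2^n*2^-n : ∀ n → + (2 ^ n) / 1 ℚ.* 2^- n ≡ 1ℚ
2^n*2^-n zero    = refl
2^n*2^-n (suc n) = begin
  + (2 * 2 ^ n) / 1 ℚ.* (½ ℚ.* 2^- n)               ≡⟨ cong (ℚ._* (½ ℚ.* 2^- n)) double ⟩
  (+ 2 / 1 ℚ.* (+ (2 ^ n) / 1)) ℚ.* (½ ℚ.* 2^- n)   ≡⟨ cong (ℚ._* (½ ℚ.* 2^- n)) (ℚₚ.*-comm (+ 2 / 1) (+ (2 ^ n) / 1)) ⟩
  ((+ (2 ^ n) / 1) ℚ.* (+ 2 / 1)) ℚ.* (½ ℚ.* 2^- n) ≡⟨ ℚₚ.*-assoc (+ (2 ^ n) / 1) _ _ ⟩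
  (+ (2 ^ n) / 1) ℚ.* ((+ 2 / 1) ℚ.* (½ ℚ.* 2^- n)) ≡⟨ cong ((+ (2 ^ n) / 1) ℚ.*_) (ℚₚ.*-assoc (+ 2 / 1) ½ (2^- n)) ⟨
  (+ (2 ^ n) / 1) ℚ.* (1ℚ ℚ.* 2^- n)                ≡⟨ cong ((+ (2 ^ n) / 1) ℚ.*_) (ℚₚ.*-identityˡ _) ⟩
  (+ (2 ^ n) / 1) ℚ.* 2^- n                         ≡⟨ 2^n*2^-n n ⟩
  1ℚ                                                ∎
  where
  open ≡-Reasoning
  double : + (2 * 2 ^ n) / 1 ≡ + 2 / 1 ℚ.* (+ (2 ^ n) / 1)
  double = ℚₚ.toℚᵘ-injective (ℚᵘₚ.≃-trans (toℚᵘ-/ (+ (2 * 2 ^ n)) 0)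
    (ℚᵘₚ.≃-sym (ℚᵘₚ.≃-trans (ℚₚ.toℚᵘ-homo-* (+ 2 / 1) (+ (2 ^ n) / 1))
      (ℚᵘₚ.≃-trans (ℚᵘₚ.*-congˡ {toℚᵘ (+ 2 / 1)} (toℚᵘ-/ (+ (2 ^ n)) 0))
        (ℚᵘ.*≡* (cong (ℤ._* + 1) (sym (ℤₚ.pos-* 2 (2 ^ n)))))))))

2^n<r : ∀ r n → 1ℚ ℚ.< + r / 1 ℚ.* 2^- n → 2 ^ n < r
2^n<r r n 1<r/2^n = ≰⇒> λ r≤2^n → ℚₚ.<-irrefl refl
  (ℚₚ.<-≤-trans 1<r/2^n (subst (+ r / 1 ℚ.* 2^- n ℚ.≤_) (2^n*2^-n n)
    (ℚₚ.*-monoʳ-≤-nonNeg (2^- n) {{2^-nonNeg n}} (/1-mono-≤ r≤2^n))))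

-- Computable lower bounds for ⌊log₂ p⌋

fromRecursive₂ : ∀ {O f} → Recursive₂ f → Computable₂ O f
fromRecursive₂ (e , ev) = computes (addOracle e) (λ φ x y → addOracle-Eval (ev x y))

module BinaryWidth
  (p : ℕ → ℝ) (a b d : ℕ → ℕ)
  (p-lower : ∀ i → fromℚ (fraction (a i) (b i) (d i) ℚ.- 1ℚ) ≤ᴿ p i)
  (p-upper : ∀ i → p i ≤ᴿ fromℚ (fraction (a i) (b i) (d i) ℚ.+ 1ℚ)) where

  q : ℕ → ℚ
  q i = fraction (a i) (b i) (d i)

  -- `a i < bound i m` expresses `q i < m` without division or subtraction.
  bound : ℕ → ℕ → ℕ
  bound i m = m * suc (d i) + b i

  -- Vanishes exactly when q i - 1 < 2 ^ suc k.
  excess : ℕ → ℕ → ℕ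
  excess k i = suc (a i) ∸ bound i (2 ^ suc k + 1)

  widthSearch : ∀ i → ∃ (IsLeastZero (λ k → excess k i))
  widthSearch i = leastZero _ (a i) (m≤n⇒m∸n≡0 (begin
    suc (a i)                                 ≤⟨ n<2^n (a i) ⟩
    2 ^ a i                                   ≤⟨ m≤m+n (2 ^ a i) _ ⟩
    2 ^ suc (a i)                             ≤⟨ m≤m+n (2 ^ suc (a i)) 1 ⟩
    2 ^ suc (a i) + 1                         ≤⟨ m≤m*n (2 ^ suc (a i) + 1) (suc (d i)) ⟩
    (2 ^ suc (a i) + 1) * suc (d i)           ≤⟨ m≤m+n _ (b i) ⟩
    (2 ^ suc (a i) + 1) * suc (d i) + b i     ∎))
    where open ≤-Reasoning

  -- Comparing a real with powers of 2 is undecidable in general, so the search uses the rational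
  -- `q i - 1`, which is at most `p i`.
  v : ℕ → ℕ
  v i = proj₁ (widthSearch i)

  a<bound : ∀ i → a i < bound i (2 ^ suc (v i) + 1)
  a<bound i = m∸n≡0⇒m≤n (proj₁ (proj₂ (widthSearch i)))

  bound≤a : ∀ i {k} → k < v i → bound i (2 ^ suc k + 1) ≤ a i
  bound≤a i {k} k<v = ≮⇒≥ λ a< → proj₂ (proj₂ (widthSearch i)) k k<v (m≤n⇒m∸n≡0 a<)

  bound-cancel-< : ∀ i {m n} → bound i m < bound i n → m < n
  bound-cancel-< i {m} {n} lt = *-cancelʳ-< (suc (d i)) m n (+-cancelʳ-< (b i) _ _ lt)

  bound-mono-≤ : ∀ i {m n} → m ≤ n → bound i m ≤ bound i n
  bound-mono-≤ i m≤n = +-monoˡ-≤ (b i) (*-monoˡ-≤ (suc (d i)) m≤n)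

  -- The chain is `x < p i ≤ q i + 1 < 2 ^ suc (v i) + 2 ≤ 2 ^ (2 + v
  -- i)`, multiplied by the denominator of `q i`. This is why blocks have width `2 + v i`.
  below-p : ∀ i {x} → fromℕ x <ᴿ p i → x < 2 ^ (2 + v i)
  below-p i {x} x<p = <-≤-trans (bound-cancel-< i (begin-strict
    bound i x                                     <⟨ ℕ<fraction+ℕ x 1 (a i) (b i) (d i)
             (fromℚ<x≤fromℚ (+ x / 1) (q i ℚ.+ 1ℚ) (p i) x<p (p-upper i)) ⟩
    a i + 1 * suc (d i)                           <⟨ +-monoˡ-< (1 * suc (d i)) (a<bound i) ⟩
    bound i (2 ^ suc (v i) + 1) + 1 * suc (d i)   ≡⟨ solve 3 (λ m e b → (m :+ con 1) :* e :+ b :+ con 1 :* e := (m :+ con 2) :* e :+ b)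
               refl (2 ^ suc (v i)) (suc (d i)) (b i) ⟩
    bound i (2 ^ suc (v i) + 2)                   ∎))
    (+-monoʳ-≤ (2 ^ suc (v i)) (≤-trans (*-monoʳ-≤ 2 (m^n>0 2 (v i))) (m≤m+n _ 0)))
    where open ≤-Reasoning

  v≤⌊log₂⌋ : ∀ i {k} → IsFloorLog₂ (p i) k → v i ≤ k
  v≤⌊log₂⌋ i {k} (_ , p<2^1+k) = ≮⇒≥ λ k<v → <⇒≱
    (fraction-1<ℕ (2 ^ suc k) (a i) (b i) (d i)
      (fromℚ≤x<fromℚ (q i ℚ.- 1ℚ) (+ (2 ^ suc k) / 1) (p i) (p-lower i) p<2^1+k))
    (bound≤a i k<v)

  v→∞ : (∀ m n → m ≤ n → p m ≤ᴿ p n) → (∀ B → ∃ λ n → B <ᴿ p n) →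
        ∀ M → ∃ λ T → ∀ i → T ≤ i → M ≤ v i
  -- The 4 is the sum of 1 from the search defining `v`, 1 from the error of `q`, and 2 from
  -- comparing through `p T`.
  v→∞ nondecreasing unbounded M with T , large ← unbounded (fromℕ (2 ^ M + 4)) =
    T , λ i T≤i → ≮⇒≥ λ v<M → <-irrefl refl (begin-strict
      bound i (2 ^ M + 4)
        <⟨ ℕ<fraction+ℕ (2 ^ M + 4) 3 (a i) (b i) (d i)
             (subst (+ (2 ^ M + 4) / 1 ℚ.<_) (ℚₚ.+-assoc (q i) 1ℚ (1ℚ ℚ.+ 1ℚ))
               (fromℚ<x≤y≤fromℚ (+ (2 ^ M + 4) / 1) (q i ℚ.+ 1ℚ) (p T) (p i) large (nondecreasing T i T≤i) (p-upper i))) ⟩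
      a i + 3 * suc (d i)
        <⟨ +-monoˡ-< (3 * suc (d i)) (a<bound i) ⟩
      bound i (2 ^ suc (v i) + 1) + 3 * suc (d i)
        ≤⟨ +-monoˡ-≤ (3 * suc (d i)) (bound-mono-≤ i (+-monoˡ-≤ 1 (^-monoʳ-≤ 2 v<M))) ⟩
      bound i (2 ^ M + 1) + 3 * suc (d i)
        ≡⟨ solve 3 (λ m e b → (m :+ con 1) :* e :+ b :+ con 3 :* e := (m :+ con 4) :* e :+ b)
               refl (2 ^ M) (suc (d i)) (b i) ⟩
      bound i (2 ^ M + 4) ∎)
    where open ≤-Reasoning

  v-computable : (∀ {O} → Computable₁ O a) → (∀ {O} → Computable₁ O b) → (∀ {O} → Computable₁ O d) →
                 ∀ {O} → Computable₁ O v
  v-computable a-computable b-computable d-computable = minimisation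
    (abs₂ (app₂ monus (app₁ succ (app₁ a-computable (var 1F)))
      (app₂ plus
        (app₂ times (app₂ plus (app₁ powerOf2 (app₁ succ (var 0F))) (const 1))
                    (app₁ succ (app₁ d-computable (var 1F))))
        (app₁ b-computable (var 1F)))))
    (λ i → proj₂ (widthSearch i))

-- The diagonalising partial recursive function

module Diagonal (U : PartialRecursive) (decode : ℕ → ℕ → ℕ) (decode-computable : Computable₂ ⊥ decode) where

  -- The numbers `a` and `b` are obtained from `θ`, so `θ` cannot contain them; it reads them from
  -- its argument instead. Halving gives `2 * y` and `1 + 2 * y` the same data `y`, a pair of
  -- parameters and a program for `U`.
  input slope intercept program : ℕ → ℕ
  input z     = π₁ ⌊ z /2⌋
  slope z     = π₁ (input z)
  intercept z = π₁ (π₂ (input z))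
  program z   = π₂ ⌊ z /2⌋

  -- If ψ (0 * x + b) ≃ θ x for all x, the zero branch makes ψ b take every value.
  output : ℕ → ℕ → ℕ
  output z u = ifZero (slope z) (intercept z) (decode (slope z * z + intercept z) u)

  output-computable : Computable₂ ⊥ output
  output-computable = abs₂ (conditional (app₁ slope′ (var 0F)) (app₁ intercept′ (var 0F))
    (app₂ decode-computable
      (app₂ plus (app₂ times (app₁ slope′ (var 0F)) (var 0F)) (app₁ intercept′ (var 0F)))
      (var 1F)))
    where
    input′ : Computable₁ ⊥ input
    input′ = abs₁ (app₁ π₁-computable (app₁ half-computable (var 0F)))
    slope′ : Computable₁ ⊥ slope
    slope′ = abs₁ (app₁ π₁-computable (app₁ input′ (var 0F)))
    intercept′ : Computable₁ ⊥ intercept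
    intercept′ = abs₁ (app₁ π₁-computable (app₁ π₂-computable (app₁ input′ (var 0F))))

  program-computable : Computable₁ ⊥ program
  program-computable = abs₁ (app₁ π₂-computable (app₁ half-computable (var 0F)))

  θ : PartialRecursive
  θ = comp (Computable₂.code output-computable)
           (proj 0F ∷ comp U (Computable₁.code program-computable ∷ []) ∷ [])

  θ-output : ∀ z {u} → U ⟨ program z ⟩⇓ u → θ ⟨ z ⟩⇓ output z u
  θ-output z U⇓u = ev-comp
    (ev-proj 0F ∷ ev-comp (Computable₁.correct program-computable _ z ∷ []) U⇓u ∷ [])
    (Computable₂.correct output-computable _ z _)

  module _ {z a b s k} (z/2 : ⌊ z /2⌋ ≡ ⟪ ⟪ a , ⟪ b , s ⟫ ⟫ , k ⟫) where

    program-⟪⟫ : program z ≡ k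
    program-⟪⟫ = trans (cong π₂ z/2) (π₂-⟪⟫ ⟪ a , ⟪ b , s ⟫ ⟫ k)

    input-⟪⟫ : input z ≡ ⟪ a , ⟪ b , s ⟫ ⟫
    input-⟪⟫ = trans (cong π₁ z/2) (π₁-⟪⟫ ⟪ a , ⟪ b , s ⟫ ⟫ k)

    slope-⟪⟫ : slope z ≡ a
    slope-⟪⟫ = trans (cong π₁ input-⟪⟫) (π₁-⟪⟫ a ⟪ b , s ⟫)

    intercept-⟪⟫ : intercept z ≡ b
    intercept-⟪⟫ = trans (cong (λ e → π₁ (π₂ e)) input-⟪⟫)
                         (trans (cong π₁ (π₂-⟪⟫ a ⟪ b , s ⟫)) (π₁-⟪⟫ b s))

    θ-⟪⟫ : ∀ {u} → U ⟨ k ⟩⇓ u → θ ⟨ z ⟩⇓ ifZero a b (decode (a * z + b) u)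
    θ-⟪⟫ {u} U⇓u = subst (θ ⟨ z ⟩⇓_) (cong₂ (λ a b → ifZero a b (decode (a * z + b) u)) slope-⟪⟫ intercept-⟪⟫)
      (θ-output z (subst (λ k → U ⟨ k ⟩⇓ u) (sym program-⟪⟫) U⇓u))

-- The lower bound on complexity

sum-applyUpTo-mono : ∀ f {m n} → m ≤ n → sum (applyUpTo f m) ≤ sum (applyUpTo f n)
sum-applyUpTo-mono f z≤n       = z≤n
sum-applyUpTo-mono f (s≤s m≤n) = +-monoʳ-≤ (f 0) (sum-applyUpTo-mono (λ i → f (suc i)) m≤n)

module Complexity
  (U : PartialRecursive) (v : ℕ → ℕ) (v-computable : ∀ {O} → Computable₁ O v)
  (v→∞ : ∀ M → ∃ λ T → ∀ i → T ≤ i → M ≤ v i) where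

  open Layout v v→∞
  open Diagonal U decode (decode-computable v-computable)

  -- The bound is put as `n ≤ F (k + c)`; leastness of the inverse of `F` turns it into the bound
  -- required by `COMPLEX`.
  incompressible :
    ∀ {X ψ} {ℓ r : ℕ → ℕ} {N} → LinearlyUniversal ψ → ¬ (∃ λ n → ψ ⟨ n ⟩⇓ X n) →
    (∀ i → X i < 2 ^ (2 + v i)) → (∀ i → v i ≤ ℓ i) → (∀ m → N ≤ m → 2 ^ m < r m) →
    ∃ λ c → ∀ n k → IsK U (applyUpTo (concatenation X) n) k → n ≤ sum (applyUpTo ℓ (r (k + c)))
  incompressible {X} {ψ} {ℓ} {r} {N} ψ-universal avoids X<2^w v≤ℓ 2^m<r with ψ-universal θ
  -- With slope 0, every value of `θ` is a value of `ψ` at `b`. An argument with `X b` in the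
  -- intercept slot gives the value `X b`, so any halting program `τ` is contradictory and every
  -- constant serves.
  ... | zero , b , ψ⇔θ = 0 , λ n k ((τ , U⇓σ , _) , _) → contradiction
    (b , Equivalence.from (ψ⇔θ (2 * ⟪ ⟪ 0 , ⟪ X b , 0 ⟫ ⟫ , ⌜ τ ⌝ ⟫) (X b))
           (θ-⟪⟫ {s = 0} (⌊2n/2⌋ _) U⇓σ))
    avoids
  ... | suc a′ , b , ψ⇔θ = N + C , bound
    where
    a = suc a′
    T = proj₁ (v→∞ (2 * a))
    -- T only serves to make the indices i₀ and i₁ large.
    e = ⟪ a , ⟪ b , T ⟫ ⟫
    -- Chosen so that `suc i₁` is at most `2 ^ k * C`. The 8 is the 2 in `z₀` times the 4 in
    -- `τ-bound`; adding `N` to `C` brings the argument of `r` past the threshold.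
    C = 1 + a * (1 + 8 * 2 ^ e) + b

    bound : ∀ n k → IsK U (applyUpTo (concatenation X) n) k → n ≤ sum (applyUpTo ℓ (r (k + (N + C))))
    bound n k ((τ , U⇓σ , τ-length) , _) = ≮⇒≥ λ F<n → impossible F<n
      where
      z₀ = 2 * ⟪ e , ⌜ τ ⌝ ⟫
      z₁ = 1 + z₀
      i₀ = a * z₀ + b
      i₁ = a * z₁ + b

      i₁≡a+i₀ : i₁ ≡ a + i₀
      i₁≡a+i₀ = trans (cong (_+ b) (*-suc a z₀)) (+-assoc a (a * z₀) b)

      T≤i₀ : T ≤ i₀
      T≤i₀ = begin
        T              ≤⟨ <⇒≤ (x<⟪e,x⟫ b T) ⟩
        ⟪ b , T ⟫      ≤⟨ <⇒≤ (x<⟪e,x⟫ a ⟪ b , T ⟫) ⟩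
        e              ≤⟨ <⇒≤ (e<⟪e,x⟫ e ⌜ τ ⌝) ⟩
        ⟪ e , ⌜ τ ⌝ ⟫  ≤⟨ m≤m+n _ _ ⟩
        z₀             ≤⟨ m≤n*m z₀ a ⟩
        a * z₀         ≤⟨ m≤m+n _ b ⟩
        i₀             ∎
        where open ≤-Reasoning

      i₁<r : suc i₁ ≤ r (k + (N + C))
      i₁<r = <⇒≤ (≤-<-trans (begin
        1 + (a * (1 + 2 * ⟪ e , ⌜ τ ⌝ ⟫) + b)
          ≡⟨ cong (λ m → 1 + (a * (1 + 2 * m) + b)) (⟪⟫-def e ⌜ τ ⌝) ⟩
        1 + (a * (1 + 2 * (2 ^ e * (1 + 2 * ⌜ τ ⌝))) + b)
          ≤⟨ s≤s (+-monoˡ-≤ b (*-monoʳ-≤ a (s≤s (*-monoʳ-≤ 2 (*-monoʳ-≤ (2 ^ e) τ-bound))))) ⟩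
        1 + (a * (1 + 2 * (2 ^ e * (4 * 2 ^ k))) + b)
          -- Terms free of `2 ^ k` are enlarged by that factor, so that it can be taken out.
          ≤⟨ +-mono-≤ 1≤P (+-mono-≤ (*-monoʳ-≤ a (+-monoˡ-≤ _ 1≤P)) (m≤n*m b (2 ^ k) {{m^n≢0 2 k}})) ⟩
        2 ^ k + (a * (2 ^ k + 2 * (2 ^ e * (4 * 2 ^ k))) + 2 ^ k * b)
          ≡⟨ solve 4 (λ P a E b → P :+ (a :* (P :+ con 2 :* (E :* (con 4 :* P))) :+ P :* b)
                       := P :* (con 1 :+ a :* (con 1 :+ con 8 :* E) :+ b)) refl (2 ^ k) a (2 ^ e) b ⟩
        2 ^ k * C
          ≤⟨ *-monoʳ-≤ (2 ^ k) (<⇒≤ (n<2^n C)) ⟩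
        2 ^ k * 2 ^ C
          ≡⟨ ^-distribˡ-+-* 2 k C ⟨
        2 ^ (k + C)
          ≤⟨ ^-monoʳ-≤ 2 (+-monoʳ-≤ k (m≤n+m C N)) ⟩
        2 ^ (k + (N + C)) ∎)
        (2^m<r (k + (N + C)) (≤-trans (m≤m+n N C) (m≤n+m (N + C) k))))
        where
        open ≤-Reasoning
        1≤P : 1 ≤ 2 ^ k
        1≤P = m^n>0 2 k
        τ-bound : 1 + 2 * ⌜ τ ⌝ ≤ 4 * 2 ^ k
        τ-bound = begin
          1 + 2 * ⌜ τ ⌝          ≤⟨ +-monoˡ-≤ (2 * ⌜ τ ⌝) {1} {4} (s≤s z≤n) ⟩
          4 + 2 * ⌜ τ ⌝          ≡⟨ *-distribˡ-+ 2 2 ⌜ τ ⌝ ⟨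
          2 * (2 + ⌜ τ ⌝)        ≤⟨ *-monoʳ-≤ 2 (subst (λ k → 2 + ⌜ τ ⌝ ≤ 2 ^ suc k) τ-length (2+⌜⌝≤2^1+length τ)) ⟩
          2 * (2 * 2 ^ k)        ≡⟨ *-assoc 2 2 (2 ^ k) ⟨
          4 * 2 ^ k              ∎

      -- The block of `i` ends within the budget of the first `r (k + (N + C))` indices, hence
      -- before `n`. So `θ` reads `X i` off the prefix computed by `τ`, and `ψ` takes the value
      -- `X i` at `i`.
      hit : ∀ z → ⌊ z /2⌋ ≡ ⟪ e , ⌜ τ ⌝ ⟫ → a * z + b ≤ i₁ → credit (a * z + b) ≢ 0 →
            ¬ sum (applyUpTo ℓ (r (k + (N + C)))) < n
      hit z z/2 i≤i₁ coded F<n = avoids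
        (i , Equivalence.from (ψ⇔θ z (X i)) (subst (θ ⟨ z ⟩⇓_)
               (decode-concatenation X i coded (X<2^w i) origin≤n) (θ-⟪⟫ z/2 U⇓σ)))
        where
        open ≤-Reasoning
        i = a * z + b
        origin≤n : origin (suc i) ≤ n
        origin≤n = begin
          origin (suc i)                             ≤⟨ origin-mono (s≤s i≤i₁) ⟩
          origin (suc i₁)                            ≤⟨ m≤m+n _ _ ⟩
          origin (suc i₁) + 2 * credit (suc i₁)      ≤⟨ origin+2credit≤ v≤ℓ (suc i₁) ⟩
          sum (applyUpTo ℓ (suc i₁))                 ≤⟨ sum-applyUpTo-mono ℓ i₁<r ⟩
          sum (applyUpTo ℓ (r (k + (N + C))))        ≤⟨ <⇒≤ F<n ⟩
          n                                          ∎

      impossible : ¬ sum (applyUpTo ℓ (r (k + (N + C)))) < n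
      -- If `i₀` is skipped, `2 * a ≤ v i₀` gives enough credit for `i₁`, which is `a` indices
      -- later, to be coded.
      impossible = [ (λ skipped → hit z₁ (⌊1+2n/2⌋ _) ≤-refl
          (subst (λ i → credit i ≢ 0) (sym i₁≡a+i₀) (next-coded a′ i₀ skipped (proj₂ (v→∞ (2 * a)) i₀ T≤i₀))))
        , hit z₀ (⌊2n/2⌋ _) (≤-trans (m≤n+m i₀ a) (≤-reflexive (sym i₁≡a+i₀)))
        ]′ (toSum (credit i₀ ≟ 0))

-- The reduction, from approximations of `p` to the bound on complexity

mainTheorem12 : (U : PartialRecursive) → IsUniversal U →
    (p : ℕ → ℝ) → (∀ n → fromℕ 1 <ᴿ p n) → IsOrderFunction p →
    (r : ℕ → ℕ) → IsOrderFunction (λ n → fromℕ (r n)) →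
    TendsTo∞ (λ n → fromℚ ((+ r n / 1) ℚ.* 2^- n)) →
    (ℓ : ℕ → ℕ) → (∀ i → IsFloorLog₂ (p i) (ℓ i)) →
    (F : ℕ → ℕ) → (∀ n → F n ≡ sum (applyUpTo ℓ (r n))) →
    (Finv : ℕ → ℕ) → IsInv (λ n → fromℕ (F n)) Finv →
    COMPLEX U (λ n → fromℕ (Finv n)) ≤ₛ LUA p
mainTheorem12 U _ p _ p-order r _ r/2^n→∞ ℓ ℓ-floor F F≡sum Finv Finv-least
  with IsOrderFunction.computable p-order | r/2^n→∞ (fromℕ 1)
... | g , (a , b , d , a-rec , b-rec , d-rec , g≡) , g-approx | N , large =
  concatenator v-computable , λ X X∈LUA →
    (λ n → bit (concatenation X n)) , concatenator-correct v-computable X ,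
    complex X X∈LUA
  where
  -- At precision 0 the error `2^- 0` is `1ℚ`, the error allowed in `BinaryWidth`.
  p-lower : ∀ i → fromℚ (fraction (a i 0) (b i 0) (d i 0) ℚ.- 1ℚ) ≤ᴿ p i
  p-lower i = subst (λ q → fromℚ (q ℚ.- 1ℚ) ≤ᴿ p i) (g≡ i 0) (proj₁ (g-approx i 0))

  p-upper : ∀ i → p i ≤ᴿ fromℚ (fraction (a i 0) (b i 0) (d i 0) ℚ.+ 1ℚ)
  p-upper i = subst (λ q → p i ≤ᴿ fromℚ (q ℚ.+ 1ℚ)) (g≡ i 0) (proj₂ (g-approx i 0))

  module W = BinaryWidth p (λ i → a i 0) (λ i → b i 0) (λ i → d i 0) p-lower p-upper
  v = W.v

  v→∞ : ∀ M → ∃ λ T → ∀ i → T ≤ i → M ≤ v i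
  v→∞ = W.v→∞ (IsOrderFunction.nondecreasing p-order) (IsOrderFunction.unbounded p-order)

  atPrecision0 : ∀ {f} → Recursive₂ f → ∀ {O} → Computable₁ O (λ i → f i 0)
  atPrecision0 f-rec = abs₁ (app₂ (fromRecursive₂ f-rec) (var 0F) (const 0))

  v-computable : ∀ {O} → Computable₁ O v
  v-computable = W.v-computable (atPrecision0 a-rec) (atPrecision0 b-rec) (atPrecision0 d-rec)

  open Layout v v→∞

  2^m<r : ∀ m → N ≤ m → 2 ^ m < r m
  2^m<r m N≤m = 2^n<r (r m) m
    (fromℚ<x≤fromℚ 1ℚ q (fromℚ q) (large m N≤m) (fromℚ-mono-≤ {q} ℚₚ.≤-refl))
    where q = + r m / 1 ℚ.* 2^- m

  complex : ∀ X → LUA p X → COMPLEX U (λ n → fromℕ (Finv n)) (λ n → bit (concatenation X n))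
  complex X (X<p , ψ , ψ-universal , avoids) =
    concatenation X , (λ _ → refl) , c , λ n k isK → fromℕ-mono-≤
      -- Since `n ≤ F (k + c)`, leastness gives `Finv n ≤ k + c`.
      (proj₂ (Finv-least n) (k + c)
        (fromℕ-mono-≤ (subst (n ≤_) (sym (F≡sum (k + c))) (bound n k isK))))
    where
    incompressibility = Complexity.incompressible U v v-computable v→∞ {r = r} {N = N} ψ-universal avoids
      (λ i → W.below-p i (X<p i)) (λ i → W.v≤⌊log₂⌋ i (ℓ-floor i)) 2^m<r
    c = proj₁ incompressibility
    bound = proj₂ incompressibility
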